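{- Let $m$ be a natural number with $m>2$. Then $m$ is prime if and only if $$\prod_{j=1}^{m-1} (2^j + 1) \equiv 1 \pmod{2^m - 1}.$$ -}

module Defs where

open import Data.Nat using (ℕ; zero; suc; _+_; _*_; _^_)

prodTerms : ℕ → ℕ
prodTerms zero = 1
prodTerms (suc k) = prodTerms k * (2 ^ suc k + 1)

{-# OPTIONS --safe #-}

-- Let M(n) = 2^n − 1 and Q(d) = ∏_{0<j<d} (2^j + 1).
--
-- For odd d, put r(j) = M(j) / M(gcd(j,d)).  Then (2^j + 1) r(j) = r(2j), and
-- doubling permutes the nonzero residues mod d, so Q(d) ∏ r(j) ≡ ∏ r(j) modulo
-- any N such that N M(g) divides M(d) for every proper divisor g of d (the
-- cyclotomic value Φ_d(2) is such an N).  Each r(j) is coprime to N,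
-- hence Q(d) ≡ 1 (mod N).  For d an odd prime, N = M(d) is allowed.
--
-- Conversely, let Q(m) ≡ 1 (mod M(m)).  If m = 2k with k > 1, then 2^k + 1
-- divides both M(m) and Q(m).  If m = s d is odd, periodicity of 2^j gives
-- 2 Q(m) ≡ (2 Q(d))^s ≡ 2^s, so N ∣ M(s − 1).  Suppose m = p q r with p, q
-- prime.  Taking d = p gives p ∣ q r − 1, which rules out p = q.  If q < p,
-- taking d = p q and N = Φ_pq(2) gives p ∣ r − 1, hence p ∣ q − 1, which is
-- absurd.

module Submission where

open import Defs
open import Data.Nat using (ℕ; zero; suc; _+_; _*_; _∸_; _^_; _≤_; _<_; z≤n; s≤s; NonZero; >-nonZero; >-nonZero⁻¹; nonTrivial⇒n>1)
open import Data.Nat.Properties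
open import Data.Nat.Divisibility using (_∣_; _∤_; _∣?_; divides; quotient; m∣n⇒n≡quotient*m; ∣-refl; ∣-reflexive; ∣-trans; ∣-antisym; ∣⇒≤; ∣1⇒≡1; ∣m∣n⇒∣m+n; ∣m+n∣m⇒∣n; ∣m⇒∣m*n; ∣n⇒∣m*n; m∣m*n; n∣m*n; *-monoʳ-∣; *-monoˡ-∣; *-cancelˡ-∣; *-cancelʳ-∣)
open import Data.Nat.DivMod using (_/_; _%_; m≡m%n+[m/n]*n; m%n<n)
open import Data.Nat.GCD using (gcd; gcd[m,n]∣m; gcd[m,n]∣n; gcd-greatest; gcd-GCD; module Bézout)
open import Data.Nat.Coprimality using (Coprime; coprime-divisor) renaming (sym to coprime-sym)
open import Data.Nat.Primality using (Prime; prime⇒irreducible; prime⇒nonTrivial; prime⇒nonZero; prime[2]; productOfPrimes≥1)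
open import Data.Nat.Primality.Factorisation using (factorise)
open import Data.Nat.Tactic.RingSolver using (solve-∀)
open import Data.List using ([]; _∷_)
open import Data.List.Relation.Unary.All using ([]; _∷_)
open import Data.Product using (∃; _,_)
open import Data.Sum using (_⊎_; inj₁; inj₂)
open import Function.Base using (_∘_)
open import Function.Bundles using (_⇔_; mk⇔)
open import Relation.Binary.Bundles using (Setoid)
open import Relation.Binary.Definitions using (tri<; tri≈; tri>)
open import Relation.Binary.PropositionalEquality using (_≡_; _≢_; refl; sym; trans; cong; cong₂; subst; module ≡-Reasoning)
import Relation.Binary.Reasoning.Setoid as SetoidReasoning
open import Relation.Nullary using (¬_; yes; no; contradiction)

-- Divisibility

coprime-*ˡ : ∀ {a b n} → Coprime a n → Coprime b n → Coprime (a * b) n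
coprime-*ˡ {a} {b} {n} a⊥n b⊥n {c} (c∣ab , c∣n) = b⊥n (coprime-divisor c⊥a c∣ab , c∣n)
  where
  c⊥a : Coprime c a
  c⊥a (e∣c , e∣a) = a⊥n (e∣a , ∣-trans e∣c c∣n)

prime∤⇒coprime : ∀ {p n} → Prime p → p ∤ n → Coprime p n
prime∤⇒coprime pr p∤n (c∣p , c∣n) with prime⇒irreducible pr c∣p
... | inj₁ c≡1  = c≡1
... | inj₂ refl = contradiction c∣n p∤n

prime>1 : ∀ {p} → Prime p → 1 < p
prime>1 {p} pr = nonTrivial⇒n>1 p {{prime⇒nonTrivial pr}}

prime⇒∤1 : ∀ {p} → Prime p → p ∤ 1
prime⇒∤1 pr p∣1 = >⇒≢ (prime>1 pr) (∣1⇒≡1 p∣1)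

prime>2⇒odd : ∀ {p} → 2 < p → Prime p → 2 ∤ p
prime>2⇒odd 2<p pr 2∣p with prime⇒irreducible pr 2∣p
... | inj₂ refl = <-irrefl refl 2<p

distinctPrimes⇒coprime : ∀ {p q} → Prime p → Prime q → p ≢ q → Coprime p q
distinctPrimes⇒coprime {p} {q} pr-p pr-q p≢q = prime∤⇒coprime pr-p p∤q
  where
  p∤q : p ∤ q
  p∤q p∣q with prime⇒irreducible pr-q p∣q
  ... | inj₁ refl = prime⇒∤1 pr-p ∣-refl
  ... | inj₂ p≡q  = p≢q p≡q

coprime⇒*-∣ : ∀ {a b n} → Coprime a b → a ∣ n → b ∣ n → a * b ∣ n
coprime⇒*-∣ {a} {b} a⊥b (divides x refl) b∣xa =
  subst (a * b ∣_) (*-comm a x)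
    (*-monoʳ-∣ a (coprime-divisor (coprime-sym a⊥b) (subst (b ∣_) (*-comm x a) b∣xa)))

k*2≡k+k : ∀ k → k * 2 ≡ k + k
k*2≡k+k = solve-∀

odd⇒≡1+2k : ∀ {n} → 2 ∤ n → ∃ λ k → n ≡ suc (k + k)
odd⇒≡1+2k {n} 2∤n with n % 2 | m≡m%n+[m/n]*n n 2 | m%n<n n 2
... | 0 | eq | _ = contradiction (divides (n / 2) eq) 2∤n
... | 1 | eq | _ = n / 2 , trans eq (cong suc (k*2≡k+k (n / 2)))
... | suc (suc _) | _ | s≤s (s≤s ())

2∤1+2k : ∀ k → 2 ∤ suc (k + k)
2∤1+2k k 2∣ = prime⇒∤1 prime[2]
  (∣m+n∣m⇒∣n (subst (2 ∣_) (+-comm 1 (k + k)) 2∣) (divides k (sym (k*2≡k+k k))))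

-- A common divisor of 2j and the odd number `d` is coprime to 2, so it already divides `j`.
gcd-double : ∀ j {d} → 2 ∤ d → gcd (j + j) d ≡ gcd j d
gcd-double j {d} 2∤d = ∣-antisym
  (gcd-greatest (coprime-divisor {n = 2} {o = j} g⊥2 (subst (g ∣_) (trans (sym (k*2≡k+k j)) (*-comm j 2)) (gcd[m,n]∣m (j + j) d)))
    (gcd[m,n]∣n (j + j) d))
  (gcd-greatest (∣m∣n⇒∣m+n (gcd[m,n]∣m j d) (gcd[m,n]∣m j d)) (gcd[m,n]∣n j d))
  where
  g = gcd (j + j) d
  g⊥2 : Coprime g 2
  g⊥2 = coprime-sym (prime∤⇒coprime prime[2] λ 2∣g → 2∤d (∣-trans 2∣g (gcd[m,n]∣n (j + j) d)))

gcd-shift : ∀ j d → gcd (d + j) d ≡ gcd j d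
gcd-shift j d = ∣-antisym
  (gcd-greatest (∣m+n∣m⇒∣n (gcd[m,n]∣m (d + j) d) (gcd[m,n]∣n (d + j) d)) (gcd[m,n]∣n (d + j) d))
  (gcd-greatest (∣m∣n⇒∣m+n (gcd[m,n]∣n j d) (gcd[m,n]∣m j d)) (gcd[m,n]∣n j d))

-- Congruences

infix 4 _≡_[mod_]

-- Multiples of `N` are added on both sides, so no subtraction on ℕ is needed. As a datatype it lets
-- `a`, `b` and `N` be inferred from the type.
data _≡_[mod_] (a b N : ℕ) : Set where
  mod≡ : ∀ k l → a + k * N ≡ b + l * N → a ≡ b [mod N ]

module _ {N : ℕ} where

  ≡mod-reflexive : ∀ {a b} → a ≡ b → a ≡ b [mod N ]
  ≡mod-reflexive refl = mod≡ 0 0 refl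

  ≡mod-sym : ∀ {a b} → a ≡ b [mod N ] → b ≡ a [mod N ]
  ≡mod-sym (mod≡ k l eq) = mod≡ l k (sym eq)

  ≡mod-trans : ∀ {a b c} → a ≡ b [mod N ] → b ≡ c [mod N ] → a ≡ c [mod N ]
  ≡mod-trans {a} {b} {c} (mod≡ k l eq) (mod≡ k′ l′ eq′) = mod≡ (k + k′) (l′ + l) (begin
    a + (k + k′) * N       ≡⟨ split a k k′ N ⟩
    (a + k * N) + k′ * N   ≡⟨ cong (_+ k′ * N) eq ⟩
    (b + l * N) + k′ * N   ≡⟨ swap b l k′ N ⟩
    (b + k′ * N) + l * N   ≡⟨ cong (_+ l * N) eq′ ⟩
    (c + l′ * N) + l * N   ≡⟨ split c l′ l N ⟨
    c + (l′ + l) * N       ∎)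
    where
    open ≡-Reasoning
    split : ∀ a k l N → a + (k + l) * N ≡ (a + k * N) + l * N
    split = solve-∀
    swap : ∀ a k l N → (a + k * N) + l * N ≡ (a + l * N) + k * N
    swap = solve-∀

  *-cong-mod : ∀ {a b c d} → a ≡ b [mod N ] → c ≡ d [mod N ] → a * c ≡ b * d [mod N ]
  *-cong-mod {a} {b} {c} {d} (mod≡ k l eq) (mod≡ k′ l′ eq′) =
    mod≡ (a * k′ + k * c + k * k′ * N) (b * l′ + l * d + l * l′ * N) (begin
      a * c + (a * k′ + k * c + k * k′ * N) * N   ≡⟨ expand a c k k′ N ⟨
      (a + k * N) * (c + k′ * N)                  ≡⟨ cong₂ _*_ eq eq′ ⟩
      (b + l * N) * (d + l′ * N)                  ≡⟨ expand b d l l′ N ⟩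
      b * d + (b * l′ + l * d + l * l′ * N) * N   ∎)
    where
    open ≡-Reasoning
    expand : ∀ a c k k′ N → (a + k * N) * (c + k′ * N) ≡ a * c + (a * k′ + k * c + k * k′ * N) * N
    expand = solve-∀

  +-congʳ-mod : ∀ {a b} c → a ≡ b [mod N ] → a + c ≡ b + c [mod N ]
  +-congʳ-mod {a} {b} c (mod≡ k l eq) =
    mod≡ k l (trans (swap a c (k * N)) (trans (cong (_+ c) eq) (swap b (l * N) c)))
    where
    swap : ∀ a b c → a + b + c ≡ a + c + b
    swap = solve-∀

  ≡mod⇒∣ : ∀ {e} b → b + e ≡ b [mod N ] → N ∣ e
  ≡mod⇒∣ {e} b (mod≡ k l eq) = ∣m+n∣m⇒∣n (divides l kN+e≡lN) (n∣m*n k)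
    where
    kN+e≡lN : k * N + e ≡ l * N
    kN+e≡lN = trans (+-comm (k * N) e) (+-cancelˡ-≡ b _ _ (trans (sym (+-assoc b e (k * N))) eq))

  ∣⇒≡mod : ∀ {e} b → N ∣ e → b + e ≡ b [mod N ]
  ∣⇒≡mod {e} b (divides l refl) = mod≡ 0 l (+-identityʳ (b + e))

  ≡mod-weaken : ∀ {L a b} → L ∣ N → a ≡ b [mod N ] → a ≡ b [mod L ]
  ≡mod-weaken {L} {a} {b} (divides x refl) (mod≡ k l eq) = mod≡ (k * x) (l * x)
    (trans (cong (a +_) (*-assoc k x L)) (trans eq (cong (b +_) (sym (*-assoc l x L)))))

  -- Write the larger of `a`, `b` as the smaller plus `e`. Then `N` divides `c * e`, and coprimality
  -- with `c` leaves `N` dividing `e`.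
  *-cancelˡ-mod : ∀ {a b} c → Coprime c N → c * a ≡ c * b [mod N ] → a ≡ b [mod N ]
  *-cancelˡ-mod {a} {b} c c⊥N ca≡cb with ≤-total a b
  ... | inj₁ a≤b with e , refl ← m≤n⇒∃[o]m+o≡n a≤b = ≡mod-sym (∣⇒≡mod a (coprime-divisor (coprime-sym c⊥N)
        (≡mod⇒∣ (c * a) (≡mod-trans (≡mod-reflexive (sym (*-distribˡ-+ c a e))) (≡mod-sym ca≡cb)))))
  ... | inj₂ b≤a with e , refl ← m≤n⇒∃[o]m+o≡n b≤a = ∣⇒≡mod b (coprime-divisor (coprime-sym c⊥N)
        (≡mod⇒∣ (c * b) (≡mod-trans (≡mod-reflexive (sym (*-distribˡ-+ c b e))) ca≡cb)))

≡mod-setoid : ℕ → Setoid _ _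
≡mod-setoid N = record
  { Carrier = ℕ
  ; _≈_ = _≡_[mod N ]
  ; isEquivalence = record { refl = ≡mod-reflexive refl ; sym = ≡mod-sym ; trans = ≡mod-trans }
  }

-- Finite products

∏ : (ℕ → ℕ) → ℕ → ℕ
∏ f zero    = 1
∏ f (suc n) = ∏ f n * f n

∏-cong : ∀ {f g} → (∀ i → f i ≡ g i) → ∀ n → ∏ f n ≡ ∏ g n
∏-cong f≗g zero    = refl
∏-cong f≗g (suc n) = cong₂ _*_ (∏-cong f≗g n) (f≗g n)

∏-cong-mod : ∀ {N f g} n → (∀ i → i < n → f i ≡ g i [mod N ]) → ∏ f n ≡ ∏ g n [mod N ]
∏-cong-mod zero    f≡g = ≡mod-reflexive refl
∏-cong-mod (suc n) f≡g = *-cong-mod (∏-cong-mod n λ i i<n → f≡g i (m≤n⇒m≤1+n i<n)) (f≡g n ≤-refl)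

∏-+ : ∀ f m n → ∏ f (m + n) ≡ ∏ f m * ∏ (λ i → f (m + i)) n
∏-+ f m zero    = trans (cong (∏ f) (+-identityʳ m)) (sym (*-identityʳ (∏ f m)))
∏-+ f m (suc n) = begin
  ∏ f (m + suc n)                                 ≡⟨ cong (∏ f) (+-suc m n) ⟩
  ∏ f (m + n) * f (m + n)                         ≡⟨ cong (_* f (m + n)) (∏-+ f m n) ⟩
  ∏ f m * ∏ (λ i → f (m + i)) n * f (m + n)       ≡⟨ *-assoc (∏ f m) _ _ ⟩
  ∏ f m * ∏ (λ i → f (m + i)) (suc n)             ∎
  where open ≡-Reasoning

∏-* : ∀ f g n → ∏ (λ i → f i * g i) n ≡ ∏ f n * ∏ g n
∏-* f g zero    = refl
∏-* f g (suc n) = trans (cong (_* (f n * g n)) (∏-* f g n)) (interchange (∏ f n) (∏ g n) (f n) (g n))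
  where
  interchange : ∀ a b c d → a * b * (c * d) ≡ a * c * (b * d)
  interchange = solve-∀

∏-even-odd : ∀ f n → ∏ f (n + n) ≡ ∏ (λ i → f (i + i)) n * ∏ (λ i → f (suc (i + i))) n
∏-even-odd f zero    = refl
∏-even-odd f (suc n) = begin
  ∏ f (suc n + suc n)                             ≡⟨ cong (λ j → ∏ f (suc j)) (+-suc n n) ⟩
  ∏ f (n + n) * f (n + n) * f (suc (n + n))       ≡⟨ cong (λ x → x * f (n + n) * f (suc (n + n))) (∏-even-odd f n) ⟩
  E * O * f (n + n) * f (suc (n + n))             ≡⟨ interchange E O (f (n + n)) (f (suc (n + n))) ⟩
  E * f (n + n) * (O * f (suc (n + n)))           ∎
  where
  open ≡-Reasoning
  E = ∏ (λ i → f (i + i)) n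
  O = ∏ (λ i → f (suc (i + i))) n
  interchange : ∀ a b c d → a * b * c * d ≡ a * c * (b * d)
  interchange = solve-∀

∏-coprime : ∀ {f N} n → (∀ i → i < n → Coprime (f i) N) → Coprime (∏ f n) N
∏-coprime zero    f⊥N (c∣1 , _) = ∣1⇒≡1 c∣1
∏-coprime (suc n) f⊥N = coprime-*ˡ (∏-coprime n λ i i<n → f⊥N i (m≤n⇒m≤1+n i<n)) (f⊥N n ≤-refl)

∣∏ : ∀ f {i n} → i < n → f i ∣ ∏ f n
∣∏ f {i} {suc n} i<1+n with m<1+n⇒m<n∨m≡n i<1+n
... | inj₁ i<n  = ∣m⇒∣m*n (f n) (∣∏ f i<n)
... | inj₂ refl = n∣m*n (∏ f n)

-- The exponent is shifted by one because `∏` starts at index 0 while the product of the theorem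
-- starts at j = 1.
term : ℕ → ℕ
term i = 2 ^ suc i + 1

prodTerms≡∏ : ∀ n → prodTerms n ≡ ∏ term n
prodTerms≡∏ zero    = refl
prodTerms≡∏ (suc n) = cong (_* term n) (prodTerms≡∏ n)

prodTerms>0 : ∀ n → 0 < prodTerms n
prodTerms>0 zero    = s≤s z≤n
prodTerms>0 (suc n) = *-mono-≤ (prodTerms>0 n) (m≤n+m 1 (2 ^ suc n))

-- Mersenne numbers

mersenne : ℕ → ℕ
mersenne n = 2 ^ n ∸ 1

1+mersenne : ∀ n → 1 + mersenne n ≡ 2 ^ n
1+mersenne n = m+[n∸m]≡n (m^n>0 2 n)

mersenne-+ : ∀ a b → mersenne (a + b) ≡ mersenne a * 2 ^ b + mersenne b
mersenne-+ a b = suc-injective (begin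
  1 + mersenne (a + b)                         ≡⟨ 1+mersenne (a + b) ⟩
  2 ^ (a + b)                                  ≡⟨ ^-distribˡ-+-* 2 a b ⟩
  2 ^ a * 2 ^ b                                ≡⟨ cong (_* 2 ^ b) (1+mersenne a) ⟨
  2 ^ b + mersenne a * 2 ^ b                   ≡⟨ +-comm (2 ^ b) _ ⟩
  mersenne a * 2 ^ b + 2 ^ b                   ≡⟨ cong (mersenne a * 2 ^ b +_) (1+mersenne b) ⟨
  mersenne a * 2 ^ b + (1 + mersenne b)        ≡⟨ +-suc (mersenne a * 2 ^ b) (mersenne b) ⟩
  1 + (mersenne a * 2 ^ b + mersenne b)        ∎)
  where open ≡-Reasoning

mersenne-double : ∀ n → mersenne (n + n) ≡ (2 ^ n + 1) * mersenne n
mersenne-double n = trans (mersenne-+ n n) (factor (mersenne n) (2 ^ n))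
  where
  factor : ∀ a b → a * b + a ≡ (b + 1) * a
  factor = solve-∀

mersenne-mono-< : ∀ {a b} → a < b → mersenne a < mersenne b
mersenne-mono-< {a} a<b = ∸-monoˡ-< (^-monoʳ-< 2 (s≤s (s≤s z≤n)) a<b) (m^n>0 2 a)

mersenne-nonZero : ∀ n .{{_ : NonZero n}} → NonZero (mersenne n)
mersenne-nonZero n = >-nonZero (mersenne-mono-< {0} {n} (>-nonZero⁻¹ n))

mersenne>1 : ∀ {n} → 1 < n → 1 < mersenne n
mersenne>1 = mersenne-mono-< {1}

mersenne-*≤ : ∀ a b → mersenne a * mersenne b ≤ mersenne (a + b)
mersenne-*≤ a b = begin
  mersenne a * mersenne b             ≤⟨ *-monoʳ-≤ (mersenne a) (m∸n≤m (2 ^ b) 1) ⟩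
  mersenne a * 2 ^ b                  ≤⟨ m≤m+n _ (mersenne b) ⟩
  mersenne a * 2 ^ b + mersenne b     ≡⟨ mersenne-+ a b ⟨
  mersenne (a + b)                    ∎
  where open ≤-Reasoning

mersenne-∣* : ∀ k a → mersenne a ∣ mersenne (k * a)
mersenne-∣* zero    a = divides 0 refl
mersenne-∣* (suc k) a = subst (mersenne a ∣_) (sym (mersenne-+ a (k * a)))
  (∣m∣n⇒∣m+n (m∣m*n (2 ^ (k * a))) (mersenne-∣* k a))

mersenne-mono-∣ : ∀ {a b} → a ∣ b → mersenne a ∣ mersenne b
mersenne-mono-∣ {a} (divides k refl) = mersenne-∣* k a

∣mersenne-cancel-+ : ∀ {c} a b → c ∣ mersenne (a + b) → c ∣ mersenne b → c ∣ mersenne a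
∣mersenne-cancel-+ {c} a b c∣ c∣b = ∣m+n∣m⇒∣n
  (subst (c ∣_) (trans (cong mersenne (+-comm a b)) (mersenne-+ b a)) c∣) (∣m⇒∣m*n (2 ^ a) c∣b)

-- Bézout writes the gcd as a difference of a multiple of `a` and a multiple of `b`. Both multiples
-- have Mersenne numbers divisible by `c`, and `∣mersenne-cancel-+` performs the subtraction of
-- exponents.
∣mersenne-gcd : ∀ {c} a b → c ∣ mersenne a → c ∣ mersenne b → c ∣ mersenne (gcd a b)
∣mersenne-gcd {c} a b c∣a c∣b with Bézout.identity (gcd-GCD a b)
... | Bézout.+- x y eq = ∣mersenne-cancel-+ (gcd a b) (y * b)
        (subst (λ n → c ∣ mersenne n) (sym eq) (∣-trans c∣a (mersenne-∣* x a))) (∣-trans c∣b (mersenne-∣* y b))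
... | Bézout.-+ x y eq = ∣mersenne-cancel-+ (gcd a b) (x * a)
        (subst (λ n → c ∣ mersenne n) (sym eq) (∣-trans c∣b (mersenne-∣* y b))) (∣-trans c∣a (mersenne-∣* x a))

mersenne-coprime : ∀ {a b} → Coprime a b → Coprime (mersenne a) (mersenne b)
mersenne-coprime {a} {b} a⊥b {c} (c∣a , c∣b) = ∣1⇒≡1
  (subst (λ g → c ∣ mersenne g) (a⊥b (gcd[m,n]∣m a b , gcd[m,n]∣n a b)) (∣mersenne-gcd a b c∣a c∣b))

∣mersenne⇒2^≡1 : ∀ {N} d → N ∣ mersenne d → 2 ^ d ≡ 1 [mod N ]
∣mersenne⇒2^≡1 d N∣ = ≡mod-trans (≡mod-reflexive (sym (1+mersenne d))) (∣⇒≡mod 1 N∣)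

2⊥mersenne : ∀ n .{{_ : NonZero n}} → Coprime 2 (mersenne n)
2⊥mersenne (suc n) {c} (c∣2 , c∣M) =
  ∣1⇒≡1 (∣m+n∣m⇒∣n (subst (c ∣_) (trans (sym (1+mersenne (suc n))) (+-comm 1 _)) (∣m⇒∣m*n (2 ^ n) c∣2)) c∣M)

-- The product modulo cyclotomic values

-- Every divisor N of Φ_d(2) qualifies.
CyclotomicDivisor : ℕ → ℕ → Set
CyclotomicDivisor d N = ∀ g → g ∣ d → g < d → N * mersenne g ∣ mersenne d

cyclotomicDivisor⇒∣ : ∀ {d N} → 1 < d → CyclotomicDivisor d N → N ∣ mersenne d
cyclotomicDivisor⇒∣ {d} {N} 1<d cyc =
  subst (_∣ mersenne d) (*-identityʳ N) (cyc 1 (divides d (sym (*-identityʳ d))) 1<d)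

module _ (k N : ℕ) (cyc : CyclotomicDivisor (suc (k + k)) N) where

  private
    d = suc (k + k)

    mg : ℕ → ℕ
    mg j = mersenne (gcd j d)

    mg∣ : ∀ j → mg j ∣ mersenne j
    mg∣ j = mersenne-mono-∣ (gcd[m,n]∣m j d)

    r : ℕ → ℕ
    r j = quotient (mg∣ j)

    r-spec : ∀ j → mersenne j ≡ r j * mg j
    r-spec j = m∣n⇒n≡quotient*m (mg∣ j)

    mg-nonZero : ∀ j → NonZero (mg j)
    mg-nonZero j = mersenne-nonZero (gcd j d)
      {{>-nonZero (n≢0⇒n>0 λ g≡0 → gcd≢0 (subst (_∣ d) g≡0 (gcd[m,n]∣n j d)))}}
      where
      gcd≢0 : 0 ∤ d
      gcd≢0 (divides x eq) = contradiction (trans eq (*-zeroʳ x)) λ ()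

    r-unique : ∀ j x → mersenne j ≡ x * mg j → r j ≡ x
    r-unique j x eq = *-cancelʳ-≡ (r j) x (mg j) {{mg-nonZero j}} (trans (sym (r-spec j)) eq)

    mg-divides : ∀ j → 0 < j → j < d → N * mg j ∣ mersenne d
    mg-divides j 0<j j<d =
      cyc (gcd j d) (gcd[m,n]∣n j d) (≤-<-trans (∣⇒≤ {{>-nonZero 0<j}} (gcd[m,n]∣m j d)) j<d)

    -- If `c` divides both `r j` and `N`, then `c * mg j` divides M(j) and M(d), hence M(gcd(j,d)),
    -- which is `mg j` itself. So `c` divides 1.
    r-coprime : ∀ j → 0 < j → j < d → Coprime (r j) N
    r-coprime j 0<j j<d {c} (c∣r , c∣N) =
      ∣1⇒≡1 (*-cancelʳ-∣ (mg j) {{mg-nonZero j}} (subst (c * mg j ∣_) (sym (*-identityˡ (mg j)))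
        (∣mersenne-gcd j d
          (subst (c * mg j ∣_) (sym (r-spec j)) (*-monoˡ-∣ (mg j) c∣r))
          (∣-trans (*-monoˡ-∣ (mg j) c∣N) (mg-divides j 0<j j<d)))))

    r-double : ∀ j → r (j + j) ≡ (2 ^ j + 1) * r j
    r-double j = r-unique (j + j) _ (begin
      mersenne (j + j)                     ≡⟨ mersenne-double j ⟩
      (2 ^ j + 1) * mersenne j             ≡⟨ cong ((2 ^ j + 1) *_) (r-spec j) ⟩
      (2 ^ j + 1) * (r j * mg j)           ≡⟨ *-assoc (2 ^ j + 1) (r j) (mg j) ⟨
      (2 ^ j + 1) * r j * mg j             ≡⟨ cong (λ g → (2 ^ j + 1) * r j * mersenne g) (gcd-double j (2∤1+2k k)) ⟨
      (2 ^ j + 1) * r j * mg (j + j)       ∎)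
      where open ≡-Reasoning

    -- M(d+j) = M(d) 2^j + M(j). After division by `mg j`, which is also `mg (d + j)`, the first
    -- summand is still a multiple of `N`.
    r-shift : ∀ j → 0 < j → j < d → r (d + j) ≡ r j [mod N ]
    r-shift j 0<j j<d with divides t eq ← mg-divides j 0<j j<d =
      ≡mod-trans (≡mod-reflexive (r-unique (d + j) (r j + t * 2 ^ j * N) (begin
        mersenne (d + j)                              ≡⟨ mersenne-+ d j ⟩
        mersenne d * 2 ^ j + mersenne j               ≡⟨ cong₂ (λ x y → x * 2 ^ j + y) eq (r-spec j) ⟩
        t * (N * mg j) * 2 ^ j + r j * mg j           ≡⟨ collect t N (mg j) (2 ^ j) (r j) ⟩
        (r j + t * 2 ^ j * N) * mg j                  ≡⟨ cong (λ g → (r j + t * 2 ^ j * N) * mersenne g) (gcd-shift j d) ⟨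
        (r j + t * 2 ^ j * N) * mg (d + j)            ∎)))
      (∣⇒≡mod (r j) (n∣m*n (t * 2 ^ j)))
      where
      open ≡-Reasoning
      collect : ∀ t N m x r → t * (N * m) * x + r * m ≡ (r + t * x * N) * m
      collect = solve-∀

    R : ℕ
    R = ∏ (λ i → r (suc i)) (k + k)

    -- j ↦ 2j sends 1,…,k to the even residues and k+1,…,2k to d plus the odd ones.
    R*prodTerms≡R : R * prodTerms (k + k) ≡ R * 1 [mod N ]
    R*prodTerms≡R = begin
      R * prodTerms (k + k)
        ≡⟨ trans (*-comm R (prodTerms (k + k))) (cong (_* R) (prodTerms≡∏ (k + k))) ⟩
      ∏ term (k + k) * R
        ≡⟨ ∏-* term (λ i → r (suc i)) (k + k) ⟨
      ∏ (λ i → term i * r (suc i)) (k + k)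
        ≡⟨ ∏-cong (λ i → sym (r-double (suc i))) (k + k) ⟩
      ∏ (λ i → r (suc i + suc i)) (k + k)
        ≡⟨ ∏-+ (λ i → r (suc i + suc i)) k k ⟩
      E * ∏ (λ i → r (suc (k + i) + suc (k + i))) k
        ≡⟨ cong (E *_) (∏-cong (λ i → cong r (shift k i)) k) ⟩
      E * ∏ (λ i → r (d + suc (i + i))) k
        ≈⟨ *-cong-mod (≡mod-reflexive {a = E} refl) (∏-cong-mod k λ i i<k → r-shift (suc (i + i)) (s≤s z≤n) (s≤s (+-mono-< i<k i<k))) ⟩
      E * O
        ≡⟨ *-comm E O ⟩
      O * E
        ≡⟨ cong (O *_) (∏-cong (λ i → cong (λ n → r (suc n)) (+-suc i i)) k) ⟩
      O * ∏ (λ i → r (suc (suc (i + i)))) k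
        ≡⟨ ∏-even-odd (λ i → r (suc i)) k ⟨
      R
        ≡⟨ *-identityʳ R ⟨
      R * 1 ∎
      where
      open SetoidReasoning (≡mod-setoid N)
      E = ∏ (λ i → r (suc i + suc i)) k
      O = ∏ (λ i → r (suc (i + i))) k
      shift : ∀ k i → suc (k + i) + suc (k + i) ≡ suc (k + k) + suc (i + i)
      shift = solve-∀

  prodTerms≡1-mod : prodTerms (k + k) ≡ 1 [mod N ]
  prodTerms≡1-mod = *-cancelˡ-mod R
    (∏-coprime (k + k) λ i i<2k → r-coprime (suc i) (s≤s z≤n) (s≤s i<2k)) R*prodTerms≡R

-- Since 2^d ≡ 1, shifting the exponent by `d` does not change a factor modulo `N`.
prodTerms-periodic : ∀ {N} d → N ∣ mersenne d → ∀ n → prodTerms (d + n) ≡ prodTerms d * prodTerms n [mod N ]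
prodTerms-periodic {N} d N∣ n = begin
  prodTerms (d + n)                           ≡⟨ prodTerms≡∏ (d + n) ⟩
  ∏ term (d + n)                              ≡⟨ ∏-+ term d n ⟩
  ∏ term d * ∏ (λ i → term (d + i)) n         ≈⟨ *-cong-mod (≡mod-reflexive {a = ∏ term d} refl) (∏-cong-mod n λ i _ → shift i) ⟩
  ∏ term d * ∏ term n                         ≡⟨ cong₂ _*_ (prodTerms≡∏ d) (prodTerms≡∏ n) ⟨
  prodTerms d * prodTerms n                   ∎
  where
  open SetoidReasoning (≡mod-setoid N)
  shift : ∀ i → term (d + i) ≡ term i [mod N ]
  shift i = +-congʳ-mod 1 (begin
    2 ^ suc (d + i)       ≡⟨ cong (2 ^_) (+-suc d i) ⟨
    2 ^ (d + suc i)       ≡⟨ ^-distribˡ-+-* 2 d (suc i) ⟩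
    2 ^ d * 2 ^ suc i     ≈⟨ *-cong-mod (∣mersenne⇒2^≡1 d N∣) (≡mod-reflexive {a = 2 ^ suc i} refl) ⟩
    1 * 2 ^ suc i         ≡⟨ *-identityˡ (2 ^ suc i) ⟩
    2 ^ suc i             ∎)

-- Completes the product to a full period: the factor with exponent `suc n` is congruent to 1 + 1.
prodTerms-suc≡2 : ∀ {N} n → N ∣ mersenne (suc n) → prodTerms n ≡ 1 [mod N ] → prodTerms (suc n) ≡ 2 [mod N ]
prodTerms-suc≡2 n N∣ Q≡1 = *-cong-mod Q≡1 (+-congʳ-mod 1 (∣mersenne⇒2^≡1 (suc n) N∣))

prodTerms-*≡2^ : ∀ {N} d → N ∣ mersenne d → prodTerms d ≡ 2 [mod N ] → ∀ s → prodTerms (s * d) ≡ 2 ^ s [mod N ]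
prodTerms-*≡2^ d N∣ Qd≡2 zero    = ≡mod-reflexive refl
prodTerms-*≡2^ d N∣ Qd≡2 (suc s) =
  ≡mod-trans (prodTerms-periodic d N∣ (s * d)) (*-cong-mod Qd≡2 (prodTerms-*≡2^ d N∣ Qd≡2 s))

-- With m = (s+1)d, the product up to exponent m is `s + 1` full periods, so it is 2^(s+1). The
-- assumption on the product up to m - 1 makes the same number 2. As `N` is odd, cancelling 2 gives
-- 2^s ≡ 1.
cyclotomicDivisor∣mersenne : ∀ {d N} s → 2 ∤ d → 1 < d → CyclotomicDivisor d N →
  prodTerms (suc s * d ∸ 1) ≡ 1 [mod N ] → N ∣ mersenne s
cyclotomicDivisor∣mersenne {d} {N} s 2∤d 1<d cyc Q≡1 with k , refl ← odd⇒≡1+2k 2∤d =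
  ≡mod⇒∣ 1 (≡mod-trans (≡mod-reflexive (1+mersenne s)) (*-cancelˡ-mod 2 2⊥N 2*2^s≡2*1))
  where
  N∣ : N ∣ mersenne d
  N∣ = cyclotomicDivisor⇒∣ 1<d cyc
  2⊥N : Coprime 2 N
  2⊥N (c∣2 , c∣N) = 2⊥mersenne d (c∣2 , ∣-trans c∣N N∣)
  2*2^s≡2*1 : 2 * 2 ^ s ≡ 2 * 1 [mod N ]
  2*2^s≡2*1 = ≡mod-trans
    (≡mod-sym (prodTerms-*≡2^ d N∣ (prodTerms-suc≡2 (k + k) N∣ (prodTerms≡1-mod k N cyc)) (suc s)))
    (prodTerms-suc≡2 (k + k + s * d) (∣-trans N∣ (mersenne-∣* (suc s) d)) Q≡1)

-- The only proper divisor of a prime is 1, and M(1) = 1.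
prime-cyclotomicDivisor : ∀ {p} → Prime p → CyclotomicDivisor p (mersenne p)
prime-cyclotomicDivisor {p} pr g g∣p g<p with prime⇒irreducible pr g∣p
... | inj₁ refl = ∣-reflexive (*-identityʳ (mersenne p))
... | inj₂ refl = contradiction g<p (<-irrefl refl)

-- If `p` does not divide `g`, coprimality puts `g` inside `q`. Otherwise g = h p with `h` dividing
-- `q`, and h = q is excluded by `g < p * q`.
properDivisor-semiprime : ∀ {p q g} → Prime p → Prime q → g ∣ p * q → g < p * q → g ∣ p ⊎ g ∣ q
properDivisor-semiprime {p} {q} {g} pr-p pr-q g∣pq g<pq with p ∣? g
... | no p∤g = inj₂ (coprime-divisor (coprime-sym (prime∤⇒coprime pr-p p∤g)) g∣pq)
... | yes (divides h refl)
      with prime⇒irreducible pr-q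
             (*-cancelˡ-∣ p {{prime⇒nonZero pr-p}} (subst (_∣ p * q) (*-comm h p) g∣pq))
...   | inj₁ refl = inj₁ (∣-reflexive (*-identityˡ p))
...   | inj₂ refl = contradiction g<pq (<-irrefl (*-comm q p))

-- For distinct `p` and `q` this `N` is Φ_pq(2). A proper divisor `g` divides `p` or `q`, so M(g)
-- divides one of the two factors next to `N`.
semiprime-cyclotomicDivisor : ∀ {p q N} → Prime p → Prime q →
  mersenne (p * q) ≡ N * (mersenne p * mersenne q) → CyclotomicDivisor (p * q) N
semiprime-cyclotomicDivisor {p} {q} {N} pr-p pr-q eq g g∣pq g<pq
  with properDivisor-semiprime pr-p pr-q g∣pq g<pq
... | inj₁ g∣p = subst (N * mersenne g ∣_) (sym eq)
        (*-monoʳ-∣ N (∣m⇒∣m*n (mersenne q) (mersenne-mono-∣ g∣p)))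
... | inj₂ g∣q = subst (N * mersenne g ∣_) (sym eq)
        (*-monoʳ-∣ N (∣n⇒∣m*n (mersenne p) (mersenne-mono-∣ g∣q)))

-- Prime divisors of m

-- Here `suc s` is the cofactor m / p. The congruence makes M(p) divide M(s); if `p` did not divide
-- `s`, these would be coprime and M(p) would be 1.
prime∣cofactor∸1 : ∀ {p} s → Prime p → 2 ∤ p →
  prodTerms (suc s * p ∸ 1) ≡ 1 [mod mersenne (suc s * p) ] → p ∣ s
prime∣cofactor∸1 {p} s pr 2∤p Q≡1 with p ∣? s
... | yes p∣s = p∣s
... | no p∤s = contradiction (mersenne-coprime (prime∤⇒coprime pr p∤s) (∣-refl , M∣))
                 (>⇒≢ (mersenne>1 (prime>1 pr)))
  where
  M∣ : mersenne p ∣ mersenne s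
  M∣ = cyclotomicDivisor∣mersenne s 2∤p (prime>1 pr) (prime-cyclotomicDivisor pr)
         (≡mod-weaken (mersenne-∣* (suc s) p) Q≡1)

-- The difference p q - (2q + p) is (p - 2)(q - 1) - 2, positive once q ≥ 3 and p ≥ 4.
2q+p<p*q : ∀ {p q} → 2 < q → q < p → q + (p + q) < p * q
-- The slacks `f` and `e` give q = 3 + f and p = 4 + f + e, which turns the claim into a polynomial
-- identity with a nonnegative remainder.
2q+p<p*q 2<q q<p with f , refl ← m≤n⇒∃[o]m+o≡n 2<q with e , refl ← m≤n⇒∃[o]m+o≡n q<p =
  subst (suc ((3 + f) + ((4 + f + e) + (3 + f))) ≤_) (sym (expand f e)) (s≤s (m≤m+n _ _))
  where
  expand : ∀ f e → (4 + f + e) * (3 + f) ≡ suc ((3 + f) + ((4 + f + e) + (3 + f)) + (1 + 4 * f + f * f + 2 * e + e * f))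
  expand = solve-∀

-- Take N = M(pq) / (M(p) M(q)), which divides M(s). If `p` did not divide `s`, then gcd(s, pq)
-- would divide `q`, so `N` would divide M(q). Then M(pq) ≤ M(q) M(p) M(q) ≤ M(2q + p), too small
-- for p q > 2q + p.
primePair∣cofactor∸1 : ∀ {p q} s → Prime p → Prime q → 2 ∤ p → 2 ∤ q → q < p →
  prodTerms (suc s * (p * q) ∸ 1) ≡ 1 [mod mersenne (suc s * (p * q)) ] → p ∣ s
primePair∣cofactor∸1 {p} {q} s pr-p pr-q 2∤p 2∤q q<p Q≡1 with p ∣? s
... | yes p∣s = p∣s
... | no p∤s = contradiction pq≤2q+p (<⇒≱ (2q+p<p*q 2<q q<p))
  where
  instance
    _ = prime⇒nonZero pr-p
    _ = prime⇒nonZero pr-q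
    _ = m*n≢0 p q
    _ = mersenne-nonZero q
  2<q : 2 < q
  2<q = ≤∧≢⇒< (prime>1 pr-q) λ { refl → 2∤q ∣-refl }
  2∤pq : 2 ∤ p * q
  2∤pq 2∣pq = 2∤q (coprime-divisor (prime∤⇒coprime prime[2] 2∤p) 2∣pq)
  1<pq : 1 < p * q
  1<pq = <-≤-trans (prime>1 pr-p) (m≤m*n p q)
  MpMq∣ : mersenne p * mersenne q ∣ mersenne (p * q)
  MpMq∣ = coprime⇒*-∣ (mersenne-coprime (distinctPrimes⇒coprime pr-p pr-q (>⇒≢ q<p)))
            (mersenne-mono-∣ (m∣m*n {p} q)) (mersenne-mono-∣ (n∣m*n p))
  N = quotient MpMq∣
  eq : mersenne (p * q) ≡ N * (mersenne p * mersenne q)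
  eq = m∣n⇒n≡quotient*m MpMq∣
  cyc : CyclotomicDivisor (p * q) N
  cyc = semiprime-cyclotomicDivisor {N = N} pr-p pr-q eq
  N∣Mpq : N ∣ mersenne (p * q)
  N∣Mpq = cyclotomicDivisor⇒∣ 1<pq cyc
  N∣Ms : N ∣ mersenne s
  N∣Ms = cyclotomicDivisor∣mersenne s 2∤pq 1<pq cyc
           (≡mod-weaken (∣-trans N∣Mpq (mersenne-∣* (suc s) (p * q))) Q≡1)
  g = gcd s (p * q)
  g∣q : g ∣ q
  g∣q = coprime-divisor (coprime-sym (prime∤⇒coprime pr-p λ p∣g → p∤s (∣-trans p∣g (gcd[m,n]∣m s (p * q)))))
          (gcd[m,n]∣n s (p * q))
  N∣Mq : N ∣ mersenne q
  N∣Mq = ∣-trans (∣mersenne-gcd s (p * q) N∣Ms N∣Mpq) (mersenne-mono-∣ g∣q)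
  pq≤2q+p : p * q ≤ q + (p + q)
  pq≤2q+p = ≮⇒≥ λ 2q+p<pq → <⇒≱ (mersenne-mono-< 2q+p<pq) (begin
    mersenne (p * q)                            ≡⟨ eq ⟩
    N * (mersenne p * mersenne q)               ≤⟨ *-mono-≤ (∣⇒≤ N∣Mq) (mersenne-*≤ p q) ⟩
    mersenne q * mersenne (p + q)               ≤⟨ mersenne-*≤ q (p + q) ⟩
    mersenne (q + (p + q))                      ∎)
    where open ≤-Reasoning

-- Excluding two odd prime factors

-- A predicate of `m` alone, so that reordering the factors of `m` rewrites product and modulus
-- together by `subst`.
MersenneCongruence : ℕ → Set
MersenneCongruence m = prodTerms (m ∸ 1) ≡ 1 [mod mersenne m ]

-- The larger prime `p` divides q(r+1) - 1, from the cofactor of `p`, and `r`, from the cofactor of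
-- `p * q`. Hence it divides q - 1, which is positive and smaller than `p`.
noOrderedPrimePair : ∀ {p q} r → Prime p → Prime q → 2 ∤ p → 2 ∤ q → q < p →
  ¬ MersenneCongruence (p * (q * suc r))
noOrderedPrimePair {p} {zero} r pr-p pr-q 2∤p 2∤q q<p cong-m = 2∤q (divides 0 refl)
noOrderedPrimePair {p} {q@(suc q′)} r pr-p pr-q 2∤p 2∤q q<p cong-m =
  <⇒≱ q<p (m≤n⇒m≤1+n (∣⇒≤ {{>-nonZero 0<q′}} p∣q′))
  where
  0<q′ : 0 < q′
  0<q′ = ≤-pred (prime>1 pr-q)
  p∣qr∸1 : p ∣ r + q′ * suc r
  p∣qr∸1 = prime∣cofactor∸1 (r + q′ * suc r) pr-p 2∤p
    (subst MersenneCongruence (*-comm p (q * suc r)) cong-m)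
  p∣r : p ∣ r
  p∣r = primePair∣cofactor∸1 r pr-p pr-q 2∤p 2∤q q<p
    (subst MersenneCongruence (rearrange p q (suc r)) cong-m)
    where
    rearrange : ∀ p q r → p * (q * r) ≡ r * (p * q)
    rearrange = solve-∀
  p∣q′ : p ∣ q′
  -- Removing `r` from q(r+1) - 1 leaves q′(r+1); removing the multiple q′ r of `p` leaves q′.
  p∣q′ = ∣m+n∣m⇒∣n (subst (p ∣_) (expand q′ r) (∣m+n∣m⇒∣n p∣qr∸1 p∣r)) (∣n⇒∣m*n q′ p∣r)
    where
    expand : ∀ q r → q * suc r ≡ q * r + q
    expand = solve-∀

-- Unequal primes are put in order by symmetry. If p = q, then `p` divides both p(r+1) and p(r+1) -
-- 1, hence 1.
noPrimePair : ∀ {p q} r → Prime p → Prime q → 2 ∤ p → 2 ∤ q → ¬ MersenneCongruence (p * (q * suc r))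
noPrimePair {p} {q} r pr-p pr-q 2∤p 2∤q cong-m with <-cmp q p
... | tri< q<p _ _ = noOrderedPrimePair r pr-p pr-q 2∤p 2∤q q<p cong-m
... | tri> _ _ p<q = noOrderedPrimePair r pr-q pr-p 2∤q 2∤p p<q
        (subst MersenneCongruence (swap p q (suc r)) cong-m)
  where
  swap : ∀ p q r → p * (q * r) ≡ q * (p * r)
  swap = solve-∀
noPrimePair {zero} r pr-p pr-q 2∤p 2∤q cong-m | tri≈ _ refl _ = 2∤p (divides 0 refl)
noPrimePair {p@(suc p′)} r pr-p pr-q 2∤p 2∤q cong-m | tri≈ _ refl _ =
  prime⇒∤1 pr-p (∣m+n∣m⇒∣n (subst (p ∣_) (+-comm 1 (r + p′ * suc r)) (m∣m*n (suc r))) p∣pr∸1)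
  where
  p∣pr∸1 : p ∣ r + p′ * suc r
  p∣pr∸1 = prime∣cofactor∸1 (r + p′ * suc r) pr-p 2∤p
    (subst MersenneCongruence (*-comm p (p * suc r)) cong-m)

-- The two directions of the equivalence

-- The product is positive, so the truncated subtraction of 1 is exact.
∣prodTerms∸1⇒congruence : ∀ {N} n → N ∣ prodTerms n ∸ 1 → prodTerms n ≡ 1 [mod N ]
∣prodTerms∸1⇒congruence n N∣ =
  ≡mod-trans (≡mod-reflexive (sym (m+[n∸m]≡n (prodTerms>0 n)))) (∣⇒≡mod 1 N∣)

congruence⇒∣prodTerms∸1 : ∀ {N} n → prodTerms n ≡ 1 [mod N ] → N ∣ prodTerms n ∸ 1
congruence⇒∣prodTerms∸1 n Q≡1 =
  ≡mod⇒∣ 1 (≡mod-trans (≡mod-reflexive (m+[n∸m]≡n (prodTerms>0 n))) Q≡1)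

-- If m = 2k with k > 1, then 2^k + 1 divides M(m), hence the product minus 1. It is also a factor
-- of the product, so it divides 1.
congruence⇒odd : ∀ {m} → 2 < m → mersenne m ∣ prodTerms (m ∸ 1) ∸ 1 → 2 ∤ m
congruence⇒odd (s≤s (s≤s ())) M∣ (divides 1 refl)
congruence⇒odd {m} 2<m M∣ (divides k@(suc (suc l)) refl) = >⇒≢ 1<c (∣1⇒≡1 c∣1)
  where
  c = 2 ^ k + 1
  1<c : 1 < c
  1<c = +-monoˡ-≤ 1 (m^n>0 2 k)
  c∣M : c ∣ mersenne m
  c∣M = subst (c ∣_) (sym (trans (cong mersenne (k*2≡k+k k)) (mersenne-double k))) (m∣m*n (mersenne k))
  c∣Q : c ∣ prodTerms (m ∸ 1)
  -- By the shift in `term`, the factor `c` with exponent k = l + 2 sits at index `suc l`; it occurs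
  -- because k ≤ m - 1.
  c∣Q = subst (c ∣_) (sym (prodTerms≡∏ (m ∸ 1))) (∣∏ term {suc l} (s≤s (s≤s (m≤n⇒m≤1+n (m≤m*n l 2)))))
  c∣1 : c ∣ 1
  c∣1 = ∣m+n∣m⇒∣n (subst (c ∣_) (trans (sym (m+[n∸m]≡n (prodTerms>0 (m ∸ 1)))) (+-comm 1 _)) c∣Q) (∣-trans c∣M M∣)

prime⇒congruence : ∀ {m} → 2 < m → Prime m → MersenneCongruence m
prime⇒congruence {m} 2<m pr with k , refl ← odd⇒≡1+2k (prime>2⇒odd 2<m pr) =
  prodTerms≡1-mod k (mersenne m) (prime-cyclotomicDivisor pr)

congruence⇒prime : ∀ {m} → 1 < m → 2 ∤ m → MersenneCongruence m → Prime m
congruence⇒prime {m} 1<m 2∤m cong-m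
  with factorise m {{>-nonZero (<-trans (s≤s z≤n) 1<m)}}
... | record { factors = [] ; isFactorisation = refl } = contradiction 1<m (<-irrefl refl)
... | record { factors = p ∷ [] ; isFactorisation = eq ; factorsPrime = pr-p ∷ [] } =
        subst Prime (sym (trans eq (*-identityʳ p))) pr-p
... | record { factors = p ∷ q ∷ ps ; isFactorisation = refl ; factorsPrime = pr-p ∷ pr-q ∷ pr-ps }
        -- The product of the remaining primes is at least 1, hence of the form `suc r` as
        -- `noPrimePair` expects.
        with r , eq ← m≤n⇒∃[o]m+o≡n (productOfPrimes≥1 pr-ps) =
        contradiction (subst (λ x → MersenneCongruence (p * (q * x))) (sym eq) cong-m)
          (noPrimePair r pr-p pr-q (2∤m ∘ ∣m⇒∣m*n _) (2∤m ∘ ∣n⇒∣m*n p ∘ ∣m⇒∣m*n _))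

theorem1 : (m : ℕ) → 2 < m → Prime m ⇔ ((2 ^ m ∸ 1) ∣ (prodTerms (m ∸ 1) ∸ 1))
theorem1 m 2<m = mk⇔
  (λ pr → congruence⇒∣prodTerms∸1 (m ∸ 1) (prime⇒congruence 2<m pr))
  (λ M∣ → congruence⇒prime (<-trans (s≤s (s≤s z≤n)) 2<m) (congruence⇒odd 2<m M∣)
            (∣prodTerms∸1⇒congruence (m ∸ 1) M∣))
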